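{- Let $\nu,\mu$ be probability measures on Cantor space $2^{\mathbb{N}}$ with full support. Then $\nu\ll_{bd}\mu$ implies $\nu\ll_{kl}\mu$.
   Context: A probability measure $\nu$ on Cantor space is identified with the function $\sigma\mapsto\nu(\sigma):=\nu([\sigma])$ on $2^{<\mathbb{N}}$, where $[\sigma]$ is the set of $\omega\in 2^{\mathbb{N}}$ extending $\sigma$; it has full support if $\nu(\sigma)>0$ for all $\sigma$. $\omega\upharpoonright n$ is the length-$n$ initial segment of $\omega$. $\nu\ll_{bd}\mu$ iff $\mathbb{E}_{\nu}\sup_n\frac{\nu(\cdot\upharpoonright n)}{\mu(\cdot\upharpoonright n)}$ (expectation of $\omega\mapsto\sup_n \frac{\nu(\omega\upharpoonright n)}{\mu(\omega\upharpoonright n)}$) is finite. $\nu\ll_{kl}\mu$ iff $\sup_n \mathbb{E}_{\nu}\ln\frac{\nu(\cdot\upharpoonright n)}{\mu(\cdot\upharpoonright n)}$ is finite. -}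

module Defs where

import Algebra.Definitions.RawMonoid as RawMonoidDefs
open import Data.Bool.Base using (Bool; true; false)
open import Data.List.Base using (List; []; _∷_; _∷ʳ_; applyUpTo)
open import Data.Integer.Base as ℤ using ()
import Data.Integer.Properties as ℤₚ
open import Data.Nat.Base as ℕ using (ℕ; zero; suc)
import Data.Nat.Coprimality as Coprime
import Data.Nat.Properties as ℕₚ
open import Data.Product.Base using (Σ; Σ-syntax; ∃; ∃-syntax; _×_; _,_; proj₁; proj₂)
open import Data.Rational.Base as ℚᵇ using (ℚ; 0ℚ; 1ℚ; ½; ∣_∣)
open import Data.Rational.Properties as ℚₚ using ()
import Data.Rational.Unnormalised.Base as ℚᵘ
import Data.Rational.Unnormalised.Properties as ℚᵘₚ
open import Data.Rational.Solver using (module +-*-Solver)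
open import Data.Sum.Base using (inj₁; inj₂)
open import Data.Unit.Base using (tt)
open import Relation.Binary.PropositionalEquality
open import Relation.Nullary.Decidable.Core using (yes; no)
open import Relation.Nullary.Negation.Core using (contradiction)

open RawMonoidDefs ℚᵇ.+-0-rawMonoid public using () renaming (_×_ to _×ℚ_)
open import Algebra.Properties.Monoid.Mult ℚₚ.+-0-monoid using (×-homo-+)

------------------------------------------------------------------------
-- Rational arithmetic

module _ where
  open ℚᵇ using (_+_; _*_; _-_; -_; _≤_; _<_)
  open +-*-Solver

  -- Total, with recip 0 = 0; this value only ever affects finitely many
  -- terms of the Cauchy sequences below.
  recip : ℚ → ℚ
  recip q with q ℚₚ.≟ 0ℚ
  ... | yes _   = 0ℚ
  ... | no  q≢0 = ℚᵇ.1/_ q {{ℚᵇ.≢-nonZero q≢0}}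

  ½^_ : ℕ → ℚ
  ½^ zero  = 1ℚ
  ½^ suc n = ½ * (½^ n)

  Σ< : ℕ → (ℕ → ℚ) → ℚ
  Σ< zero    f = 0ℚ
  Σ< (suc n) f = Σ< n f + f n

  -- The left Riemann sum of ∫₁ˣ dt/t with 2ⁿ subintervals of (signed)
  -- length h = (x - 1)/2ⁿ.
  lnSum : ℕ → ℚ → ℚ
  lnSum n x = Σ< (2 ℕ.^ n) (λ i → h * recip (1ℚ + i ×ℚ h))
    where h = (x - 1ℚ) * (½^ n)

  module ℚ-Lemmas where

    *-mono-≤ : ∀ {a b c d} → 0ℚ ≤ a → 0ℚ ≤ d → a ≤ b → c ≤ d → a * c ≤ b * d
    *-mono-≤ {a} {b} {c} {d} 0≤a 0≤d a≤b c≤d = ℚₚ.≤-trans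
      (ℚₚ.*-monoˡ-≤-nonNeg a {{ℚᵇ.nonNegative 0≤a}} c≤d)
      (ℚₚ.*-monoʳ-≤-nonNeg d {{ℚᵇ.nonNegative 0≤d}} a≤b)

    *-nonNeg : ∀ {a b} → 0ℚ ≤ a → 0ℚ ≤ b → 0ℚ ≤ a * b
    *-nonNeg {a} {b} 0≤a 0≤b =
      subst (_≤ a * b) (ℚₚ.*-zeroʳ a)
        (ℚₚ.*-monoˡ-≤-nonNeg a {{ℚᵇ.nonNegative 0≤a}} 0≤b)

    *-pos : ∀ {a b} → 0ℚ < a → 0ℚ < b → 0ℚ < a * b
    *-pos {a} {b} 0<a 0<b =
      subst (_< a * b) (ℚₚ.*-zeroʳ a)
        (ℚₚ.*-monoʳ-<-pos a {{ℚᵇ.positive 0<a}} 0<b)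

    0≤½^ : ∀ n → 0ℚ ≤ ½^ n
    0≤½^ zero    = ℚₚ.≤ᵇ⇒≤ tt
    0≤½^ (suc n) = *-nonNeg {½} (ℚₚ.≤ᵇ⇒≤ tt) (0≤½^ n)

    0<1 : 0ℚ < 1ℚ
    0<1 = ℚₚ.positive⁻¹ 1ℚ

    0<½ : 0ℚ < ½
    0<½ = ℚₚ.positive⁻¹ ½

    q≤∣q∣ : ∀ q → q ≤ ∣ q ∣
    q≤∣q∣ q with ℚₚ.≤-total 0ℚ q
    ... | inj₁ 0≤q = ℚₚ.≤-reflexive (sym (ℚₚ.0≤p⇒∣p∣≡p 0≤q))
    ... | inj₂ q≤0 = ℚₚ.≤-trans q≤0 (ℚₚ.0≤∣p∣ q)

    recip-inverse : ∀ {q} → 0ℚ < q → q * recip q ≡ 1ℚ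
    recip-inverse {q} 0<q with q ℚₚ.≟ 0ℚ
    ... | yes q≡0 = contradiction (sym q≡0) (ℚₚ.<⇒≢ 0<q)
    ... | no  q≢0 = ℚₚ.*-inverseʳ q {{ℚᵇ.≢-nonZero q≢0}}

    0<recip : ∀ {q} → 0ℚ < q → 0ℚ < recip q
    0<recip {q} 0<q with q ℚₚ.≟ 0ℚ
    ... | yes q≡0 = contradiction (sym q≡0) (ℚₚ.<⇒≢ 0<q)
    ... | no  q≢0 = ℚₚ.positive⁻¹ _ {{ℚₚ.1/pos⇒pos q {{ℚᵇ.positive 0<q}}}}

    recip-difference : ∀ {a b} → 0ℚ < a → 0ℚ < b →
                       recip a - recip b ≡ (b - a) * (recip a * recip b)
    recip-difference {a} {b} 0<a 0<b = begin
      ra - rb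
        ≡⟨ cong₂ _-_ (sym (ℚₚ.*-identityˡ ra)) (sym (ℚₚ.*-identityˡ rb)) ⟩
      1ℚ * ra - 1ℚ * rb
        ≡⟨ cong₂ (λ u v → u * ra - v * rb)
             (sym (recip-inverse 0<b)) (sym (recip-inverse 0<a)) ⟩
      b * rb * ra - a * ra * rb
        ≡⟨ solve 4 (λ a b ra rb → b :* rb :* ra :- a :* ra :* rb
                                  := (b :- a) :* (ra :* rb)) refl a b ra rb ⟩
      (b - a) * (ra * rb) ∎
      where
        open ≡-Reasoning
        ra = recip a
        rb = recip b

    recip-antimono : ∀ {a b} → 0ℚ < a → a ≤ b → recip b ≤ recip a
    recip-antimono {a} {b} 0<a a≤b = begin
      rb              ≡⟨ ℚₚ.*-identityʳ rb ⟨
      rb * 1ℚ         ≡⟨ cong (rb *_) (recip-inverse 0<a) ⟨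
      rb * (a * ra)   ≤⟨ ℚₚ.*-monoˡ-≤-nonNeg rb {{nn rb 0<rb}}
                           (ℚₚ.*-monoʳ-≤-nonNeg ra {{nn ra (0<recip 0<a)}} a≤b) ⟩
      rb * (b * ra)   ≡⟨ solve 3 (λ b ra rb → rb :* (b :* ra) := b :* rb :* ra)
                           refl b ra rb ⟩
      b * rb * ra     ≡⟨ cong (_* ra) (recip-inverse 0<b) ⟩
      1ℚ * ra         ≡⟨ ℚₚ.*-identityˡ ra ⟩
      ra              ∎
      where
        open ℚₚ.≤-Reasoning
        ra = recip a
        rb = recip b
        0<b = ℚₚ.<-≤-trans 0<a a≤b
        0<rb = 0<recip 0<b
        nn : ∀ q → 0ℚ < q → ℚᵇ.NonNegative q
        nn q 0<q = ℚᵇ.nonNegative (ℚₚ.<⇒≤ 0<q)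

    0≤recip : ∀ {q} → 0ℚ < q → 0ℚ ≤ recip q
    0≤recip 0<q = ℚₚ.<⇒≤ (0<recip 0<q)

    ∣recip-difference∣ : ∀ {δ a b} → 0ℚ < δ → δ ≤ a → δ ≤ b →
      ∣ recip a - recip b ∣ ≤ ∣ b - a ∣ * (recip δ * recip δ)
    ∣recip-difference∣ {δ} {a} {b} 0<δ δ≤a δ≤b = begin
      ∣ recip a - recip b ∣
        ≡⟨ cong ∣_∣ (recip-difference 0<a 0<b) ⟩
      ∣ (b - a) * (recip a * recip b) ∣
        ≡⟨ ℚₚ.∣p*q∣≡∣p∣*∣q∣ (b - a) _ ⟩
      ∣ b - a ∣ * ∣ recip a * recip b ∣
        ≡⟨ cong (∣ b - a ∣ *_)
             (ℚₚ.0≤p⇒∣p∣≡p (*-nonNeg (0≤recip 0<a) (0≤recip 0<b))) ⟩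
      ∣ b - a ∣ * (recip a * recip b)
        ≤⟨ ℚₚ.*-monoˡ-≤-nonNeg ∣ b - a ∣ {{ℚₚ.∣-∣-nonNeg (b - a)}}
             (*-mono-≤ (0≤recip 0<a) (0≤recip 0<δ)
               (recip-antimono 0<δ δ≤a) (recip-antimono 0<δ δ≤b)) ⟩
      ∣ b - a ∣ * (recip δ * recip δ) ∎
      where
        open ℚₚ.≤-Reasoning
        0<a = ℚₚ.<-≤-trans 0<δ δ≤a
        0<b = ℚₚ.<-≤-trans 0<δ δ≤b

    triangle : ∀ a b c → ∣ a - c ∣ ≤ ∣ a - b ∣ + ∣ b - c ∣
    triangle a b c =
      subst (λ z → ∣ z ∣ ≤ ∣ a - b ∣ + ∣ b - c ∣)
        (solve 3 (λ a b c → (a :- b) :+ (b :- c) := a :- c) refl a b c)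
        (ℚₚ.∣p+q∣≤∣p∣+∣q∣ (a - b) (b - c))

    ∣a-b∣≡∣b-a∣ : ∀ a b → ∣ a - b ∣ ≡ ∣ b - a ∣
    ∣a-b∣≡∣b-a∣ a b = trans (sym (ℚₚ.∣-p∣≡∣p∣ (a - b)))
      (cong ∣_∣ (solve 2 (λ a b → :- (a :- b) := b :- a) refl a b))

    ×-* : ∀ n p q → n ×ℚ (p * q) ≡ (n ×ℚ p) * q
    ×-* zero    p q = sym (ℚₚ.*-zeroˡ q)
    ×-* (suc n) p q = trans (cong (p * q +_) (×-* n p q))
                            (sym (ℚₚ.*-distribʳ-+ q p (n ×ℚ p)))

    ×-nonNeg : ∀ n {q} → 0ℚ ≤ q → 0ℚ ≤ n ×ℚ q
    ×-nonNeg zero    0≤q = ℚₚ.≤-refl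
    ×-nonNeg (suc n) 0≤q = ℚₚ.+-mono-≤ 0≤q (×-nonNeg n 0≤q)

    ×-monoˡ : ∀ {m n q} → 0ℚ ≤ q → m ℕ.≤ n → m ×ℚ q ≤ n ×ℚ q
    ×-monoˡ {n = n} 0≤q ℕ.z≤n = ×-nonNeg n 0≤q
    ×-monoˡ {q = q} 0≤q (ℕ.s≤s m≤n) = ℚₚ.+-monoʳ-≤ q (×-monoˡ 0≤q m≤n)

    2^1+n≡ : ∀ n → 2 ℕ.^ suc n ≡ 2 ℕ.^ n ℕ.+ 2 ℕ.^ n
    2^1+n≡ n = cong (2 ℕ.^ n ℕ.+_) (ℕₚ.+-identityʳ (2 ℕ.^ n))

    ½+½ : ∀ q → ½ * q + ½ * q ≡ q
    ½+½ q = trans (sym (ℚₚ.*-distribʳ-+ q ½ ½)) (ℚₚ.*-identityˡ q)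

    2^n×½^n≡1 : ∀ n → (2 ℕ.^ n) ×ℚ (½^ n) ≡ 1ℚ
    2^n×½^n≡1 zero    = refl
    2^n×½^n≡1 (suc n) = begin
      (2 ℕ.^ suc n) ×ℚ (½ * p)        ≡⟨ cong (_×ℚ (½ * p)) (2^1+n≡ n) ⟩
      (N ℕ.+ N) ×ℚ (½ * p)            ≡⟨ ×-homo-+ (½ * p) N N ⟩
      N ×ℚ (½ * p) + N ×ℚ (½ * p)     ≡⟨ cong (λ q → N ×ℚ q + N ×ℚ q) (ℚₚ.*-comm ½ p) ⟩
      N ×ℚ (p * ½) + N ×ℚ (p * ½)     ≡⟨ cong (λ q → q + q) (×-* N p ½) ⟩
      (N ×ℚ p) * ½ + (N ×ℚ p) * ½     ≡⟨ cong (λ q → q * ½ + q * ½) (2^n×½^n≡1 n) ⟩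
      1ℚ ∎
      where
        open ≡-Reasoning
        N = 2 ℕ.^ n
        p = ½^ n

    ι : ℕ → ℚ
    ι n = ℚᵇ.mkℚ (ℤ.+ n) 0 (Coprime.sym (Coprime.1-coprimeTo n))

    ι-suc : ∀ n → 1ℚ + ι n ≡ ι (suc n)
    ι-suc n = trans
      (cong (λ m → (ℤ.+ 1 ℤ.+ m) ℚᵇ./ 1) (ℤₚ.*-identityʳ (ℤ.+ n)))
      (ℚₚ.↥p/↧p≡p (ι (suc n)))

    ×≡ι* : ∀ n q → n ×ℚ q ≡ ι n * q
    ×≡ι* zero q = sym (ℚₚ.*-zeroˡ q)
    ×≡ι* (suc n) q = begin
      q + n ×ℚ q   ≡⟨ cong₂ _+_ (sym (ℚₚ.*-identityˡ q)) (×≡ι* n q) ⟩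
      1ℚ * q + ι n * q ≡⟨ ℚₚ.*-distribʳ-+ q 1ℚ (ι n) ⟨
      (1ℚ + ι n) * q ≡⟨ cong (_* q) (ι-suc n) ⟩
      ι (suc n) * q ∎
      where open ≡-Reasoning

    archimedean : ∀ {ε} → 0ℚ < ε → 1ℚ ≤ (ℚᵇ.↧ₙ ε) ×ℚ ε
    archimedean {ε@(ℚᵇ.mkℚ ℤ.+[1+ n ] d c)} 0<ε = subst (1ℚ ≤_) (sym (×≡ι* (suc d) ε))
      (ℚₚ.toℚᵘ-cancel-≤ (ℚᵘₚ.≤-respʳ-≃ (ℚᵘₚ.≃-sym (ℚₚ.toℚᵘ-homo-* (ι (suc d)) ε))
        (ℚᵘ.*≤* (ℤ.+≤+ (begin
          1 ℕ.* (1 ℕ.* suc d)       ≡⟨ ℕₚ.*-identityˡ (1 ℕ.* suc d) ⟩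
          1 ℕ.* suc d               ≡⟨ ℕₚ.*-identityˡ (suc d) ⟩
          suc d                     ≤⟨ ℕₚ.m≤m*n (suc d) (suc n) ⟩
          suc d ℕ.* suc n           ≡⟨ ℕₚ.*-identityʳ (suc d ℕ.* suc n) ⟨
          suc d ℕ.* suc n ℕ.* 1     ∎)))))
      where open ℕₚ.≤-Reasoning
    archimedean {ℚᵇ.mkℚ (ℤ.+ 0) d c} (ℚᵇ.*<* (ℤ.+<+ ()))
    archimedean {ℚᵇ.mkℚ ℤ.-[1+ n ] d c} (ℚᵇ.*<* ())

    ½^-antimono : ∀ {m n} → m ℕ.≤ n → ½^ n ≤ ½^ m
    ½^-antimono {n = zero}  ℕ.z≤n = ℚₚ.≤-refl
    ½^-antimono {n = suc n} ℕ.z≤n =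
      ℚₚ.≤-trans (½*≤ (0≤½^ n)) (½^-antimono {n = n} ℕ.z≤n)
      where
        ½*≤ : ∀ {q} → 0ℚ ≤ q → ½ * q ≤ q
        ½*≤ {q} 0≤q = subst₂ _≤_ (ℚₚ.+-identityˡ (½ * q)) (½+½ q)
          (ℚₚ.+-monoˡ-≤ (½ * q) (*-nonNeg {½} (ℚₚ.≤ᵇ⇒≤ tt) 0≤q))
    ½^-antimono (ℕ.s≤s m≤n) =
      ℚₚ.*-monoˡ-≤-nonNeg ½ (½^-antimono m≤n)

    n<2^n : ∀ n → n ℕ.< 2 ℕ.^ n
    n<2^n zero    = ℕ.s≤s ℕ.z≤n
    n<2^n (suc n) = subst (suc n ℕ.<_) (sym (2^1+n≡ n))
      (ℕₚ.+-mono-≤ (ℕₚ.≤-trans (ℕ.s≤s ℕ.z≤n) (n<2^n n)) (n<2^n n))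

    ×-cancel : ∀ n {p q} → (suc n) ×ℚ p ≤ (suc n) ×ℚ q → p ≤ q
    ×-cancel n {p} {q} np≤nq = ℚₚ.*-cancelˡ-≤-pos (ι (suc n))
      (subst₂ _≤_ (×≡ι* (suc n) p) (×≡ι* (suc n) q) np≤nq)

    ½^-small : ∀ {ε} → 0ℚ < ε → ∃[ N ] ½^ N ≤ ε
    ½^-small {ε} 0<ε = N , ×-cancel (ℚ.denominator-1 ε) (begin
      N ×ℚ (½^ N)           ≤⟨ ×-monoˡ (0≤½^ N) (ℕₚ.<⇒≤ (n<2^n N)) ⟩
      (2 ℕ.^ N) ×ℚ (½^ N)   ≡⟨ 2^n×½^n≡1 N ⟩
      1ℚ                    ≤⟨ archimedean 0<ε ⟩
      N ×ℚ ε                ∎)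
      where
        open ℚₚ.≤-Reasoning
        N = ℚᵇ.↧ₙ ε

    Σ<-close : ∀ N {f g c} → (∀ i → i ℕ.< N → ∣ f i - g i ∣ ≤ c) →
               ∣ Σ< N f - Σ< N g ∣ ≤ N ×ℚ c
    Σ<-close zero    f≈g = ℚₚ.≤-refl
    Σ<-close (suc N) {f} {g} {c} f≈g = begin
      ∣ (F + f N) - (G + g N) ∣      ≡⟨ cong ∣_∣ (solve 4
                                          (λ F f G g → (F :+ f) :- (G :+ g)
                                                    := (f :- g) :+ (F :- G))
                                          refl F (f N) G (g N)) ⟩
      ∣ (f N - g N) + (F - G) ∣      ≤⟨ ℚₚ.∣p+q∣≤∣p∣+∣q∣ (f N - g N) (F - G) ⟩
      ∣ f N - g N ∣ + ∣ F - G ∣      ≤⟨ ℚₚ.+-mono-≤ (f≈g N ℕₚ.≤-refl)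
                                          (Σ<-close N (λ i i<N → f≈g i (ℕₚ.m<n⇒m<1+n i<N))) ⟩
      c + N ×ℚ c ∎
      where
        open ℚₚ.≤-Reasoning
        F = Σ< N f
        G = Σ< N g

    Σ<-pairs : ∀ N f → Σ< (N ℕ.+ N) f ≡ Σ< N (λ i → f (i ℕ.+ i) + f (suc (i ℕ.+ i)))
    Σ<-pairs zero    f = refl
    Σ<-pairs (suc N) f = begin
      Σ< (N ℕ.+ suc N) f + f (N ℕ.+ suc N)
        ≡⟨ cong (λ k → Σ< k f + f k) (ℕₚ.+-suc N N) ⟩
      Σ< (N ℕ.+ N) f + f (N ℕ.+ N) + f (suc (N ℕ.+ N))
        ≡⟨ ℚₚ.+-assoc (Σ< (N ℕ.+ N) f) (f (N ℕ.+ N)) (f (suc (N ℕ.+ N))) ⟩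
      Σ< (N ℕ.+ N) f + (f (N ℕ.+ N) + f (suc (N ℕ.+ N)))
        ≡⟨ cong (_+ (f (N ℕ.+ N) + f (suc (N ℕ.+ N)))) (Σ<-pairs N f) ⟩
      Σ< N (λ i → f (i ℕ.+ i) + f (suc (i ℕ.+ i))) + (f (N ℕ.+ N) + f (suc (N ℕ.+ N))) ∎
      where open ≡-Reasoning

    module LnSum {δ} (0<δ : 0ℚ < δ) (δ≤1 : δ ≤ 1ℚ) where

      D² : ℚ
      D² = recip δ * recip δ

      mesh : ℕ → ℚ → ℚ
      mesh n x = (x - 1ℚ) * (½^ n)

      node : ℕ → ℚ → ℕ → ℚ
      node n x i = 1ℚ + i ×ℚ mesh n x

      t : ℕ → ℕ → ℚ
      t n i = i ×ℚ (½^ n)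

      node≡ : ∀ n x i → node n x i ≡ 1ℚ + t n i * (x - 1ℚ)
      node≡ n x i = cong (1ℚ +_)
        (trans (cong (i ×ℚ_) (ℚₚ.*-comm (x - 1ℚ) (½^ n))) (×-* i (½^ n) (x - 1ℚ)))

      δ≤node : ∀ n {x} i → δ ≤ x → i ℕ.≤ 2 ℕ.^ n → δ ≤ node n x i
      δ≤node n {x} i δ≤x i≤2^n = begin
        δ                           ≡⟨ solve 2 (λ s δ → δ := (con 1ℚ :- s) :* δ :+ s :* δ)
                                         refl s δ ⟩
        (1ℚ - s) * δ + s * δ        ≤⟨ ℚₚ.+-mono-≤
                                         (ℚₚ.*-monoˡ-≤-nonNeg (1ℚ - s) {{ℚᵇ.nonNegative 0≤1-s}} δ≤1)
                                         (ℚₚ.*-monoˡ-≤-nonNeg s {{ℚᵇ.nonNegative 0≤s}} δ≤x) ⟩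
        (1ℚ - s) * 1ℚ + s * x       ≡⟨ solve 2 (λ s x → (con 1ℚ :- s) :* con 1ℚ :+ s :* x
                                                     := con 1ℚ :+ s :* (x :- con 1ℚ))
                                         refl s x ⟩
        1ℚ + s * (x - 1ℚ)           ≡⟨ node≡ n x i ⟨
        node n x i                  ∎
        where
          open ℚₚ.≤-Reasoning
          s = t n i
          0≤s : 0ℚ ≤ s
          0≤s = ×-nonNeg i (0≤½^ n)
          0≤1-s : 0ℚ ≤ 1ℚ - s
          0≤1-s = ℚₚ.≤-trans (ℚₚ.≤-reflexive (sym (ℚₚ.+-inverseʳ s)))
            (ℚₚ.+-monoˡ-≤ (ℚᵇ.- s)
              (ℚₚ.≤-trans (×-monoˡ (0≤½^ n) i≤2^n) (ℚₚ.≤-reflexive (2^n×½^n≡1 n))))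

      recip²≤ : ∀ {a b} → δ ≤ a → δ ≤ b → ∣ recip a * recip b ∣ ≤ D²
      recip²≤ {a} {b} δ≤a δ≤b = ℚₚ.≤-trans
        (ℚₚ.≤-reflexive (ℚₚ.0≤p⇒∣p∣≡p (*-nonNeg (0≤recip 0<a) (0≤recip 0<b))))
        (*-mono-≤ (0≤recip 0<a) (0≤recip 0<δ)
                  (recip-antimono 0<δ δ≤a) (recip-antimono 0<δ δ≤b))
        where
          0<a = ℚₚ.<-≤-trans 0<δ δ≤a
          0<b = ℚₚ.<-≤-trans 0<δ δ≤b

      2^n×½^n*c≡c : ∀ n c → (2 ℕ.^ n) ×ℚ ((½^ n) * c) ≡ c
      2^n×½^n*c≡c n c = trans (×-* (2 ℕ.^ n) (½^ n) c)
        (trans (cong (_* c) (2^n×½^n≡1 n)) (ℚₚ.*-identityˡ c))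

      lipschitz : ∀ n {x y} → δ ≤ x → δ ≤ y →
                  ∣ lnSum n x - lnSum n y ∣ ≤ ∣ x - y ∣ * D²
      lipschitz n {x} {y} δ≤x δ≤y =
        subst (∣ lnSum n x - lnSum n y ∣ ≤_) (2^n×½^n*c≡c n (∣ x - y ∣ * D²))
          (Σ<-close (2 ℕ.^ n) close)
        where
          p = ½^ n
          close : ∀ i → i ℕ.< 2 ℕ.^ n →
            ∣ mesh n x * recip (node n x i) - mesh n y * recip (node n y i) ∣
              ≤ p * (∣ x - y ∣ * D²)
          close i i<N = begin
            ∣ mesh n x * ra - mesh n y * rb ∣
              ≡⟨ cong ∣_∣ (cong₂ (λ u v → mesh n x * u - mesh n y * v)
                   (sym (ℚₚ.*-identityˡ ra)) (sym (ℚₚ.*-identityˡ rb))) ⟩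
            ∣ mesh n x * (1ℚ * ra) - mesh n y * (1ℚ * rb) ∣
              ≡⟨ cong ∣_∣ (cong₂ (λ u v → mesh n x * (u * ra) - mesh n y * (v * rb))
                   (trans (sym (recip-inverse 0<b)) (cong (_* rb) (node≡ n y i)))
                   (trans (sym (recip-inverse 0<a)) (cong (_* ra) (node≡ n x i)))) ⟩
            ∣ mesh n x * ((1ℚ + s * (y - 1ℚ)) * rb * ra)
              - mesh n y * ((1ℚ + s * (x - 1ℚ)) * ra * rb) ∣
              ≡⟨ cong ∣_∣ (solve 6 (λ x y p s ra rb →
                   ((x :- con 1ℚ) :* p) :* ((con 1ℚ :+ s :* (y :- con 1ℚ)) :* rb :* ra)
                     :- ((y :- con 1ℚ) :* p) :* ((con 1ℚ :+ s :* (x :- con 1ℚ)) :* ra :* rb)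
                   := p :* ((x :- y) :* (ra :* rb))) refl x y p s ra rb) ⟩
            ∣ p * ((x - y) * (ra * rb)) ∣
              ≡⟨ trans (ℚₚ.∣p*q∣≡∣p∣*∣q∣ p _)
                   (cong₂ _*_ (ℚₚ.0≤p⇒∣p∣≡p (0≤½^ n)) (ℚₚ.∣p*q∣≡∣p∣*∣q∣ (x - y) _)) ⟩
            p * (∣ x - y ∣ * ∣ ra * rb ∣)
              ≤⟨ ℚₚ.*-monoˡ-≤-nonNeg p {{ℚᵇ.nonNegative (0≤½^ n)}}
                   (ℚₚ.*-monoˡ-≤-nonNeg ∣ x - y ∣ {{ℚₚ.∣-∣-nonNeg (x - y)}}
                     (recip²≤ δ≤a δ≤b)) ⟩
            p * (∣ x - y ∣ * D²) ∎
            where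
              open ℚₚ.≤-Reasoning
              s = t n i
              a = node n x i
              b = node n y i
              ra = recip a
              rb = recip b
              δ≤a = δ≤node n i δ≤x (ℕₚ.<⇒≤ i<N)
              δ≤b = δ≤node n i δ≤y (ℕₚ.<⇒≤ i<N)
              0<a = ℚₚ.<-≤-trans 0<δ δ≤a
              0<b = ℚₚ.<-≤-trans 0<δ δ≤b

      module _ {x A} (δ≤x : δ ≤ x) (∣x-1∣≤A : ∣ x - 1ℚ ∣ ≤ A) where

        C : ℚ
        C = ½ * (A * A * D²)

        0≤A : 0ℚ ≤ A
        0≤A = ℚₚ.≤-trans (ℚₚ.0≤∣p∣ (x - 1ℚ)) ∣x-1∣≤A

        refine : ∀ n → ∣ lnSum (suc n) x - lnSum n x ∣ ≤ (½^ suc n) * C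
        refine n = subst₂ (λ S T → ∣ S - lnSum n x ∣ ≤ T)
          (sym (trans (cong (λ N → Σ< N f) (2^1+n≡ n)) (Σ<-pairs (2 ℕ.^ n) f)))
          (2^n×½^n*c≡c n ((½^ suc n) * C))
          (Σ<-close (2 ℕ.^ n) close)
          where
            p = ½^ n
            h′ = mesh (suc n) x
            f : ℕ → ℚ
            f i = h′ * recip (node (suc n) x i)
            h≡ : mesh n x ≡ h′ + h′
            h≡ = trans (cong ((x - 1ℚ) *_) (sym (½+½ p)))
                       (ℚₚ.*-distribˡ-+ (x - 1ℚ) (½ * p) (½ * p))
            even : ∀ i → node (suc n) x (i ℕ.+ i) ≡ node n x i
            even i = cong (1ℚ +_) (begin
              (i ℕ.+ i) ×ℚ h′    ≡⟨ ×-homo-+ h′ i i ⟩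
              i ×ℚ h′ + i ×ℚ h′  ≡⟨ ×-distrib-+ i h′ ⟩
              i ×ℚ (h′ + h′)     ≡⟨ cong (i ×ℚ_) h≡ ⟨
              i ×ℚ mesh n x      ∎)
              where
                open ≡-Reasoning
                ×-distrib-+ : ∀ i q → i ×ℚ q + i ×ℚ q ≡ i ×ℚ (q + q)
                ×-distrib-+ zero    q = refl
                ×-distrib-+ (suc i) q = trans
                  (solve 2 (λ q s → (q :+ s) :+ (q :+ s) := (q :+ q) :+ (s :+ s))
                    refl q (i ×ℚ q))
                  (cong (q + q +_) (×-distrib-+ i q))
            close : ∀ i → i ℕ.< 2 ℕ.^ n →
              ∣ f (i ℕ.+ i) + f (suc (i ℕ.+ i)) - mesh n x * recip (node n x i) ∣
                ≤ p * ((½^ suc n) * C)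
            close i i<N = begin
              ∣ f (i ℕ.+ i) + h′ * rb - mesh n x * ra ∣
                ≡⟨ cong ∣_∣ (cong₂ (λ u v → h′ * recip u + h′ * rb - v * ra) (even i) h≡) ⟩
              ∣ h′ * ra + h′ * rb - (h′ + h′) * ra ∣
                ≡⟨ cong ∣_∣ (solve 3 (λ h ra rb → h :* ra :+ h :* rb :- (h :+ h) :* ra
                                              := h :* (rb :- ra)) refl h′ ra rb) ⟩
              ∣ h′ * (rb - ra) ∣
                ≡⟨ ℚₚ.∣p*q∣≡∣p∣*∣q∣ h′ (rb - ra) ⟩
              ∣ h′ ∣ * ∣ rb - ra ∣
                ≤⟨ ℚₚ.*-monoˡ-≤-nonNeg ∣ h′ ∣ {{ℚₚ.∣-∣-nonNeg h′}}
                     (∣recip-difference∣ 0<δ δ≤b δ≤a) ⟩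
              ∣ h′ ∣ * (∣ a - b ∣ * D²)
                ≡⟨ cong (λ q → ∣ h′ ∣ * (q * D²)) ∣a-b∣≡∣h′∣ ⟩
              ∣ h′ ∣ * (∣ h′ ∣ * D²)
                ≤⟨ *-mono-≤ (ℚₚ.0≤∣p∣ h′) (*-nonNeg 0≤A½p 0≤D²) ∣h′∣≤
                     (ℚₚ.*-monoʳ-≤-nonNeg D² {{ℚᵇ.nonNegative 0≤D²}} ∣h′∣≤) ⟩
              (A * (½ * p)) * ((A * (½ * p)) * D²)
                ≡⟨ solve 3 (λ A p D → (A :* (con ½ :* p)) :* ((A :* (con ½ :* p)) :* D)
                                   := p :* ((con ½ :* p) :* (con ½ :* (A :* A :* D))))
                     refl A p D² ⟩
              p * ((½ * p) * C) ∎
              where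
                open ℚₚ.≤-Reasoning
                a = node n x i
                b = node (suc n) x (suc (i ℕ.+ i))
                ra = recip a
                rb = recip b
                0≤½p : 0ℚ ≤ ½ * p
                0≤½p = 0≤½^ (suc n)
                0≤A½p = *-nonNeg 0≤A 0≤½p
                0≤D² : 0ℚ ≤ D²
                0≤D² = *-nonNeg (0≤recip 0<δ) (0≤recip 0<δ)
                δ≤a = δ≤node n i δ≤x (ℕₚ.<⇒≤ i<N)
                2i+1≤ : suc (i ℕ.+ i) ℕ.≤ 2 ℕ.^ suc n
                2i+1≤ = subst (suc (i ℕ.+ i) ℕ.≤_) (sym (2^1+n≡ n))
                          (ℕₚ.+-mono-≤ i<N (ℕₚ.<⇒≤ i<N))
                δ≤b = δ≤node (suc n) (suc (i ℕ.+ i)) δ≤x 2i+1≤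
                ∣h′∣≤ : ∣ h′ ∣ ≤ A * (½ * p)
                ∣h′∣≤ = ℚₚ.≤-trans
                  (ℚₚ.≤-reflexive (trans (ℚₚ.∣p*q∣≡∣p∣*∣q∣ (x - 1ℚ) (½ * p))
                    (cong (∣ x - 1ℚ ∣ *_) (ℚₚ.0≤p⇒∣p∣≡p 0≤½p))))
                  (ℚₚ.*-monoʳ-≤-nonNeg (½ * p) {{ℚᵇ.nonNegative 0≤½p}} ∣x-1∣≤A)
                ∣a-b∣≡∣h′∣ : ∣ a - b ∣ ≡ ∣ h′ ∣
                ∣a-b∣≡∣h′∣ = trans
                  (cong (λ q → ∣ q - b ∣) (sym (even i)))
                  (trans (cong ∣_∣ (solve 2 (λ s h → (con 1ℚ :+ s) :- (con 1ℚ :+ (h :+ s)) := :- h)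
                            refl ((i ℕ.+ i) ×ℚ h′) h′))
                         (ℚₚ.∣-p∣≡∣p∣ h′))

        0≤C : 0ℚ ≤ C
        0≤C = *-nonNeg {½} (ℚₚ.≤ᵇ⇒≤ tt)
                (*-nonNeg (*-nonNeg 0≤A 0≤A) (*-nonNeg (0≤recip 0<δ) (0≤recip 0<δ)))

        refine^ : ∀ n k → ∣ lnSum (k ℕ.+ n) x - lnSum n x ∣ + (½^ (k ℕ.+ n)) * C ≤ (½^ n) * C
        refine^ n zero = ℚₚ.≤-reflexive (trans
          (cong (λ q → ∣ q ∣ + (½^ n) * C) (ℚₚ.+-inverseʳ (lnSum n x)))
          (ℚₚ.+-identityˡ ((½^ n) * C)))
        refine^ n (suc k) = begin
          ∣ lnSum (suc m) x - lnSum n x ∣ + q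
            ≤⟨ ℚₚ.+-monoˡ-≤ q (triangle (lnSum (suc m) x) (lnSum m x) (lnSum n x)) ⟩
          ∣ lnSum (suc m) x - lnSum m x ∣ + d + q
            ≤⟨ ℚₚ.+-monoˡ-≤ q (ℚₚ.+-monoˡ-≤ d (refine m)) ⟩
          q + d + q
            ≡⟨ solve 2 (λ q d → q :+ d :+ q := d :+ (q :+ q)) refl q d ⟩
          d + (q + q)
            ≡⟨ cong (d +_) (trans (sym (ℚₚ.*-distribʳ-+ C (½ * (½^ m)) (½ * (½^ m))))
                 (cong (_* C) (½+½ (½^ m)))) ⟩
          d + (½^ m) * C
            ≤⟨ refine^ n k ⟩
          (½^ n) * C ∎
          where
            open ℚₚ.≤-Reasoning
            m = k ℕ.+ n
            q = (½^ suc m) * C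
            d = ∣ lnSum m x - lnSum n x ∣

        refine-≤ : ∀ {n m} → n ℕ.≤ m → ∣ lnSum m x - lnSum n x ∣ ≤ (½^ n) * C
        refine-≤ {n} {m} n≤m = begin
          ∣ lnSum m x - lnSum n x ∣
            ≡⟨ ℚₚ.+-identityʳ _ ⟨
          ∣ lnSum m x - lnSum n x ∣ + 0ℚ
            ≤⟨ ℚₚ.+-monoʳ-≤ ∣ lnSum m x - lnSum n x ∣ (*-nonNeg (0≤½^ m) 0≤C) ⟩
          ∣ lnSum m x - lnSum n x ∣ + (½^ m) * C
            ≡⟨ cong (λ k → ∣ lnSum k x - lnSum n x ∣ + (½^ k) * C) (ℕₚ.m∸n+n≡m n≤m) ⟨
          ∣ lnSum (m ℕ.∸ n ℕ.+ n) x - lnSum n x ∣ + (½^ (m ℕ.∸ n ℕ.+ n)) * C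
            ≤⟨ refine^ n (m ℕ.∸ n) ⟩
          (½^ n) * C ∎
          where open ℚₚ.≤-Reasoning

------------------------------------------------------------------------
-- Real numbers: Cauchy sequences of rationals, with modulus

record ℝ : Set where
  constructor mkℝ
  open ℚᵇ using (_-_; _≤_; _<_)
  field
    seq    : ℕ → ℚ
    cauchy : ∀ {ε} → 0ℚ < ε →
             ∃[ N ] (∀ {m n} → N ℕ.≤ m → N ℕ.≤ n → ∣ seq m - seq n ∣ ≤ ε)

open ℝ public

infix  4 _≈_ _≤_ _<_
infixl 6 _+_
infixl 7 _*_

_≈_ : ℝ → ℝ → Set
x ≈ y = ∀ {ε} → 0ℚ ℚᵇ.< ε →
  ∃[ N ] (∀ {n} → N ℕ.≤ n → ∣ seq x n ℚᵇ.- seq y n ∣ ℚᵇ.≤ ε)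

_≤_ : ℝ → ℝ → Set
x ≤ y = ∀ {ε} → 0ℚ ℚᵇ.< ε →
  ∃[ N ] (∀ {n} → N ℕ.≤ n → seq x n ℚᵇ.≤ seq y n ℚᵇ.+ ε)

_<_ : ℝ → ℝ → Set
x < y = ∃[ ε ] (0ℚ ℚᵇ.< ε ×
  ∃[ N ] (∀ {n} → N ℕ.≤ n → seq x n ℚᵇ.+ ε ℚᵇ.≤ seq y n))

fromℚ : ℚ → ℝ
fromℚ q = mkℝ (λ _ → q) (λ 0<ε → 0 , λ _ _ →
  ℚₚ.≤-trans (ℚₚ.≤-reflexive (cong ∣_∣ (ℚₚ.+-inverseʳ q))) (ℚₚ.<⇒≤ 0<ε))

0ℝ 1ℝ : ℝ
0ℝ = fromℚ 0ℚ
1ℝ = fromℚ 1ℚ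

module ℝ-Lemmas where
  open ℚᵇ using (_⊓_) renaming (_+_ to _⊕_; _*_ to _⊛_; _-_ to _⊖_; _≤_ to _≼_; _<_ to _≺_)
  open ℚ-Lemmas
  open +-*-Solver

  mkCauchy : ∀ {s : ℕ → ℚ} K → 0ℚ ≼ K →
    (∀ {ε} → 0ℚ ≺ ε →
      ∃[ N ] (∀ {m n} → N ℕ.≤ m → N ℕ.≤ n → ∣ s m ⊖ s n ∣ ≼ K ⊛ ε)) →
    ∀ {ε} → 0ℚ ≺ ε →
      ∃[ N ] (∀ {m n} → N ℕ.≤ m → N ℕ.≤ n → ∣ s m ⊖ s n ∣ ≼ ε)
  mkCauchy K 0≤K c {ε} 0<ε = proj₁ (c 0<ε′) , λ N≤m N≤n →
    ℚₚ.≤-trans (proj₂ (c 0<ε′) N≤m N≤n) Kε′≤ε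
    where
      0<1+K : 0ℚ ≺ 1ℚ ⊕ K
      0<1+K = ℚₚ.+-mono-<-≤ 0<1 0≤K
      ε′ = recip (1ℚ ⊕ K) ⊛ ε
      0<ε′ : 0ℚ ≺ ε′
      0<ε′ = *-pos (0<recip 0<1+K) 0<ε
      open ℚₚ.≤-Reasoning
      Kε′≤ε : K ⊛ ε′ ≼ ε
      Kε′≤ε = begin
        K ⊛ ε′                            ≡⟨ ℚₚ.+-identityˡ (K ⊛ ε′) ⟨
        0ℚ ⊕ K ⊛ ε′                       ≤⟨ ℚₚ.+-monoˡ-≤ (K ⊛ ε′) (ℚₚ.<⇒≤ 0<ε′) ⟩
        ε′ ⊕ K ⊛ ε′                       ≡⟨ solve 3 (λ K r ε → r :* ε :+ K :* (r :* ε)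
                                               := ((con 1ℚ :+ K) :* r) :* ε)
                                               refl K (recip (1ℚ ⊕ K)) ε ⟩
        (1ℚ ⊕ K) ⊛ recip (1ℚ ⊕ K) ⊛ ε     ≡⟨ cong (_⊛ ε) (recip-inverse 0<1+K) ⟩
        1ℚ ⊛ ε                            ≡⟨ ℚₚ.*-identityˡ ε ⟩
        ε                                 ∎

  bounded : ∀ x → ∃[ A ] (0ℚ ≼ A × ∃[ N ] (∀ {n} → N ℕ.≤ n → ∣ seq x n ∣ ≼ A))
  bounded x = 1ℚ ⊕ ∣ seq x N ∣
            , ℚₚ.+-mono-≤ (ℚₚ.<⇒≤ 0<1) (ℚₚ.0≤∣p∣ (seq x N))
            , N , λ {n} N≤n → begin
    ∣ seq x n ∣
      ≡⟨ cong ∣_∣ (solve 2 (λ a b → a := (a :- b) :+ b) refl (seq x n) (seq x N)) ⟩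
    ∣ (seq x n ⊖ seq x N) ⊕ seq x N ∣
      ≤⟨ ℚₚ.∣p+q∣≤∣p∣+∣q∣ (seq x n ⊖ seq x N) (seq x N) ⟩
    ∣ seq x n ⊖ seq x N ∣ ⊕ ∣ seq x N ∣
      ≤⟨ ℚₚ.+-monoˡ-≤ ∣ seq x N ∣ (proj₂ (cauchy x 0<1) N≤n ℕₚ.≤-refl) ⟩
    1ℚ ⊕ ∣ seq x N ∣ ∎
    where
      open ℚₚ.≤-Reasoning
      N = proj₁ (cauchy x 0<1)

  positive : ∀ {x} → 0ℝ < x →
    ∃[ δ ] (0ℚ ≺ δ × ∃[ N ] (∀ {n} → N ℕ.≤ n → δ ≼ seq x n))
  positive {x} (δ , 0<δ , N , h) =
    δ , 0<δ , N , λ {n} N≤n → subst (_≼ seq x n) (ℚₚ.+-identityˡ δ) (h N≤n)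

  ⊔₁ : ∀ {l m n} → l ℕ.⊔ m ℕ.≤ n → l ℕ.≤ n
  ⊔₁ {l} {m} = ℕₚ.≤-trans (ℕₚ.m≤m⊔n l m)

  ⊔₂ : ∀ {l m n} → l ℕ.⊔ m ℕ.≤ n → m ℕ.≤ n
  ⊔₂ {l} {m} = ℕₚ.≤-trans (ℕₚ.m≤n⊔m l m)

  -- For the four operations below: a bound on the variation of the result
  -- in terms of explicit moduli and bounds of the arguments.

  CauchyFrom : ℕ → ℚ → (ℕ → ℚ) → Set
  CauchyFrom N ε s = ∀ {m n} → N ℕ.≤ m → N ℕ.≤ n → ∣ s m ⊖ s n ∣ ≼ ε

  +-variation : ∀ {s t M N ε} → CauchyFrom M ε s → CauchyFrom N ε t →
    CauchyFrom (M ℕ.⊔ N) ((1ℚ ⊕ 1ℚ) ⊛ ε) (λ n → s n ⊕ t n)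
  +-variation {s} {t} {M} {N} {ε} cs ct {m} {n} ≤m ≤n = begin
    ∣ (s m ⊕ t m) ⊖ (s n ⊕ t n) ∣
      ≡⟨ cong ∣_∣ (solve 4 (λ a b c d → (a :+ b) :- (c :+ d) := (a :- c) :+ (b :- d))
           refl (s m) (t m) (s n) (t n)) ⟩
    ∣ (s m ⊖ s n) ⊕ (t m ⊖ t n) ∣
      ≤⟨ ℚₚ.∣p+q∣≤∣p∣+∣q∣ (s m ⊖ s n) (t m ⊖ t n) ⟩
    ∣ s m ⊖ s n ∣ ⊕ ∣ t m ⊖ t n ∣
      ≤⟨ ℚₚ.+-mono-≤ (cs (⊔₁ {M} {N} ≤m) (⊔₁ {M} {N} ≤n)) (ct (⊔₂ {M} {N} ≤m) (⊔₂ {M} {N} ≤n)) ⟩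
    ε ⊕ ε
      ≡⟨ cong₂ _⊕_ (ℚₚ.*-identityˡ ε) (ℚₚ.*-identityˡ ε) ⟨
    1ℚ ⊛ ε ⊕ 1ℚ ⊛ ε
      ≡⟨ ℚₚ.*-distribʳ-+ ε 1ℚ 1ℚ ⟨
    (1ℚ ⊕ 1ℚ) ⊛ ε ∎
    where open ℚₚ.≤-Reasoning

  +-cauchy : ∀ x y {ε} → 0ℚ ≺ ε → ∃[ N ] CauchyFrom N ε (λ n → seq x n ⊕ seq y n)
  +-cauchy x y = mkCauchy {λ n → seq x n ⊕ seq y n} (1ℚ ⊕ 1ℚ) (ℚₚ.≤ᵇ⇒≤ tt) λ 0<ε →
    _ , +-variation {seq x} {seq y} (proj₂ (cauchy x 0<ε)) (proj₂ (cauchy y 0<ε))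

  *-variation : ∀ {s t A B K L M N ε} → 0ℚ ≼ B → 0ℚ ≺ ε →
    (∀ {n} → K ℕ.≤ n → ∣ s n ∣ ≼ A) → (∀ {n} → L ℕ.≤ n → ∣ t n ∣ ≼ B) →
    CauchyFrom M ε s → CauchyFrom N ε t →
    CauchyFrom ((K ℕ.⊔ L) ℕ.⊔ (M ℕ.⊔ N)) ((A ⊕ B) ⊛ ε) (λ n → s n ⊛ t n)
  *-variation {s} {t} {A} {B} {K} {L} {M} {N} {ε} 0≤B 0<ε bs bt cs ct {m} {n} ≤m ≤n = begin
    ∣ s m ⊛ t m ⊖ s n ⊛ t n ∣
      ≡⟨ cong ∣_∣ (solve 4 (λ a b c d → (a :* b) :- (c :* d) := a :* (b :- d) :+ (a :- c) :* d)
           refl (s m) (t m) (s n) (t n)) ⟩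
    ∣ s m ⊛ (t m ⊖ t n) ⊕ (s m ⊖ s n) ⊛ t n ∣
      ≤⟨ ℚₚ.∣p+q∣≤∣p∣+∣q∣ (s m ⊛ (t m ⊖ t n)) ((s m ⊖ s n) ⊛ t n) ⟩
    ∣ s m ⊛ (t m ⊖ t n) ∣ ⊕ ∣ (s m ⊖ s n) ⊛ t n ∣
      ≡⟨ cong₂ _⊕_ (ℚₚ.∣p*q∣≡∣p∣*∣q∣ (s m) (t m ⊖ t n)) (ℚₚ.∣p*q∣≡∣p∣*∣q∣ (s m ⊖ s n) (t n)) ⟩
    ∣ s m ∣ ⊛ ∣ t m ⊖ t n ∣ ⊕ ∣ s m ⊖ s n ∣ ⊛ ∣ t n ∣
      ≤⟨ ℚₚ.+-mono-≤
           (*-mono-≤ (ℚₚ.0≤∣p∣ (s m)) (ℚₚ.<⇒≤ 0<ε)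
             (bs (⊔₁ {K} {L} (bd ≤m))) (ct (⊔₂ {M} {N} (cy ≤m)) (⊔₂ {M} {N} (cy ≤n))))
           (*-mono-≤ (ℚₚ.0≤∣p∣ (s m ⊖ s n)) 0≤B
             (cs (⊔₁ {M} {N} (cy ≤m)) (⊔₁ {M} {N} (cy ≤n))) (bt (⊔₂ {K} {L} (bd ≤n)))) ⟩
    A ⊛ ε ⊕ ε ⊛ B
      ≡⟨ cong (A ⊛ ε ⊕_) (ℚₚ.*-comm ε B) ⟩
    A ⊛ ε ⊕ B ⊛ ε
      ≡⟨ ℚₚ.*-distribʳ-+ ε A B ⟨
    (A ⊕ B) ⊛ ε ∎
    where
      open ℚₚ.≤-Reasoning
      bd = ⊔₁ {K ℕ.⊔ L} {M ℕ.⊔ N}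
      cy = ⊔₂ {K ℕ.⊔ L} {M ℕ.⊔ N}

  *-cauchy : ∀ x y {ε} → 0ℚ ≺ ε → ∃[ N ] CauchyFrom N ε (λ n → seq x n ⊛ seq y n)
  *-cauchy x y = go (bounded x) (bounded y)
    where
      go : (∃[ A ] (0ℚ ≼ A × ∃[ N ] (∀ {n} → N ℕ.≤ n → ∣ seq x n ∣ ≼ A))) →
           (∃[ B ] (0ℚ ≼ B × ∃[ N ] (∀ {n} → N ℕ.≤ n → ∣ seq y n ∣ ≼ B))) →
           ∀ {ε} → 0ℚ ≺ ε → ∃[ N ] CauchyFrom N ε (λ n → seq x n ⊛ seq y n)
      go (A , 0≤A , K , bx) (B , 0≤B , L , by) =
        mkCauchy {λ n → seq x n ⊛ seq y n} (A ⊕ B) (ℚₚ.+-mono-≤ 0≤A 0≤B) λ 0<ε →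
          _ , *-variation {seq x} {seq y} {K = K} {L} 0≤B 0<ε bx by
                (proj₂ (cauchy x 0<ε)) (proj₂ (cauchy y 0<ε))

  recip-variation : ∀ {s δ M N ε} → 0ℚ ≺ δ → (∀ {n} → M ℕ.≤ n → δ ≼ s n) → CauchyFrom N ε s →
    CauchyFrom (M ℕ.⊔ N) ((recip δ ⊛ recip δ) ⊛ ε) (λ n → recip (s n))
  recip-variation {s} {δ} {M} {N} {ε} 0<δ δ≤s cs {m} {n} ≤m ≤n = begin
    ∣ recip (s m) ⊖ recip (s n) ∣
      ≤⟨ ∣recip-difference∣ 0<δ (δ≤s (⊔₁ {M} {N} ≤m)) (δ≤s (⊔₁ {M} {N} ≤n)) ⟩
    ∣ s n ⊖ s m ∣ ⊛ D²
      ≤⟨ ℚₚ.*-monoʳ-≤-nonNeg D² {{ℚᵇ.nonNegative (*-nonNeg (0≤recip 0<δ) (0≤recip 0<δ))}}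
           (cs (⊔₂ {M} {N} ≤n) (⊔₂ {M} {N} ≤m)) ⟩
    ε ⊛ D²
      ≡⟨ ℚₚ.*-comm ε D² ⟩
    D² ⊛ ε ∎
    where
      open ℚₚ.≤-Reasoning
      D² = recip δ ⊛ recip δ

  recip-cauchy : ∀ x → 0ℝ < x → ∀ {ε} → 0ℚ ≺ ε → ∃[ N ] CauchyFrom N ε (λ n → recip (seq x n))
  recip-cauchy x 0<x = go (positive {x} 0<x)
    where
      go : (∃[ δ ] (0ℚ ≺ δ × ∃[ N ] (∀ {n} → N ℕ.≤ n → δ ≼ seq x n))) →
           ∀ {ε} → 0ℚ ≺ ε → ∃[ N ] CauchyFrom N ε (λ n → recip (seq x n))
      go (δ , 0<δ , M , δ≤x) =
        mkCauchy {λ n → recip (seq x n)} (recip δ ⊛ recip δ)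
          (*-nonNeg (0≤recip 0<δ) (0≤recip 0<δ)) λ 0<ε →
            _ , recip-variation {seq x} {M = M} 0<δ δ≤x (proj₂ (cauchy x 0<ε))

  ln-variation : ∀ {s δ A M N ε} (0<δ : 0ℚ ≺ δ) (δ≤1 : δ ≼ 1ℚ) → 0ℚ ≼ A →
    (∀ {n} → M ℕ.≤ n → δ ≼ s n) → (∀ {n} → M ℕ.≤ n → ∣ s n ⊖ 1ℚ ∣ ≼ A) →
    CauchyFrom N ε s → ½^ N ≼ ε →
    let D² = recip δ ⊛ recip δ
        C  = ½ ⊛ (A ⊛ A ⊛ D²)
    in CauchyFrom (M ℕ.⊔ N) ((C ⊕ (D² ⊕ C)) ⊛ ε) (λ n → lnSum n (s n))
  ln-variation {s} {δ} {A} {M} {N} {ε} 0<δ δ≤1 0≤A δ≤s s-1≤A cs ½^N≤ε {m} {n} ≤m ≤n = begin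
    ∣ Sm ⊖ Sn ∣
      ≤⟨ triangle Sm Tm Sn ⟩
    ∣ Sm ⊖ Tm ∣ ⊕ ∣ Tm ⊖ Sn ∣
      ≤⟨ ℚₚ.+-monoʳ-≤ ∣ Sm ⊖ Tm ∣ (triangle Tm Tn Sn) ⟩
    ∣ Sm ⊖ Tm ∣ ⊕ (∣ Tm ⊖ Tn ∣ ⊕ ∣ Tn ⊖ Sn ∣)
      ≤⟨ ℚₚ.+-mono-≤ (tail ≤m) (ℚₚ.+-mono-≤ mid
           (ℚₚ.≤-trans (ℚₚ.≤-reflexive (∣a-b∣≡∣b-a∣ Tn Sn)) (tail ≤n))) ⟩
    C ⊛ ε ⊕ (D² ⊛ ε ⊕ C ⊛ ε)
      ≡⟨ cong (C ⊛ ε ⊕_) (ℚₚ.*-distribʳ-+ ε D² C) ⟨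
    C ⊛ ε ⊕ (D² ⊕ C) ⊛ ε
      ≡⟨ ℚₚ.*-distribʳ-+ ε C (D² ⊕ C) ⟨
    (C ⊕ (D² ⊕ C)) ⊛ ε ∎
    where
      open ℚₚ.≤-Reasoning
      open LnSum 0<δ δ≤1 using (lipschitz; refine-≤)
      D² = recip δ ⊛ recip δ
      C  = ½ ⊛ (A ⊛ A ⊛ D²)
      P  = M ℕ.⊔ N
      Sm = lnSum m (s m)
      Sn = lnSum n (s n)
      Tm = lnSum P (s m)
      Tn = lnSum P (s n)
      0≤D² : 0ℚ ≼ D²
      0≤D² = *-nonNeg (0≤recip 0<δ) (0≤recip 0<δ)
      0≤C : 0ℚ ≼ C
      0≤C = *-nonNeg {½} (ℚₚ.<⇒≤ 0<½) (*-nonNeg (*-nonNeg 0≤A 0≤A) 0≤D²)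
      tail : ∀ {k} → P ℕ.≤ k → ∣ lnSum k (s k) ⊖ lnSum P (s k) ∣ ≼ C ⊛ ε
      tail {k} ≤k = begin
        ∣ lnSum k (s k) ⊖ lnSum P (s k) ∣
          ≤⟨ refine-≤ (δ≤s (⊔₁ {M} {N} ≤k)) (s-1≤A (⊔₁ {M} {N} ≤k)) ≤k ⟩
        (½^ P) ⊛ C
          ≤⟨ ℚₚ.*-monoʳ-≤-nonNeg C {{ℚᵇ.nonNegative 0≤C}}
               (ℚₚ.≤-trans (½^-antimono (ℕₚ.m≤n⊔m M N)) ½^N≤ε) ⟩
        ε ⊛ C
          ≡⟨ ℚₚ.*-comm ε C ⟩
        C ⊛ ε ∎
      mid : ∣ Tm ⊖ Tn ∣ ≼ D² ⊛ ε
      mid = begin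
        ∣ Tm ⊖ Tn ∣
          ≤⟨ lipschitz P (δ≤s (⊔₁ {M} {N} ≤m)) (δ≤s (⊔₁ {M} {N} ≤n)) ⟩
        ∣ s m ⊖ s n ∣ ⊛ D²
          ≤⟨ ℚₚ.*-monoʳ-≤-nonNeg D² {{ℚᵇ.nonNegative 0≤D²}}
               (cs (⊔₂ {M} {N} ≤m) (⊔₂ {M} {N} ≤n)) ⟩
        ε ⊛ D²
          ≡⟨ ℚₚ.*-comm ε D² ⟩
        D² ⊛ ε ∎

  0<⊓1 : ∀ {δ} → 0ℚ ≺ δ → 0ℚ ≺ δ ⊓ 1ℚ
  0<⊓1 {δ} 0<δ with ℚₚ.≤-total δ 1ℚ
  ... | inj₁ δ≤1 = subst (0ℚ ≺_) (sym (ℚₚ.p≤q⇒p⊓q≡p δ≤1)) 0<δ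
  ... | inj₂ 1≤δ = subst (0ℚ ≺_) (sym (ℚₚ.p≥q⇒p⊓q≡q 1≤δ)) 0<1

  ln-cauchy : ∀ x → 0ℝ < x → ∀ {ε} → 0ℚ ≺ ε → ∃[ N ] CauchyFrom N ε (λ n → lnSum n (seq x n))
  ln-cauchy x 0<x = go (positive {x} 0<x) (bounded x)
    where
      go : (∃[ δ ] (0ℚ ≺ δ × ∃[ N ] (∀ {n} → N ℕ.≤ n → δ ≼ seq x n))) →
           (∃[ A ] (0ℚ ≼ A × ∃[ N ] (∀ {n} → N ℕ.≤ n → ∣ seq x n ∣ ≼ A))) →
           ∀ {ε} → 0ℚ ≺ ε → ∃[ N ] CauchyFrom N ε (λ n → lnSum n (seq x n))
      go (δ₀ , 0<δ₀ , K , δ₀≤x) (A₀ , 0≤A₀ , L , x≤A₀) =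
        mkCauchy {λ n → lnSum n (seq x n)} (C ⊕ (D² ⊕ C))
          (ℚₚ.+-mono-≤ 0≤C (ℚₚ.+-mono-≤ 0≤D² 0≤C)) λ {ε} 0<ε →
            let M = proj₁ (cauchy x 0<ε)
                N = proj₁ (½^-small 0<ε)
            in _ , ln-variation {seq x} {δ} {A} {K ℕ.⊔ L} {M ℕ.⊔ N} 0<δ (ℚₚ.p⊓q≤q δ₀ 1ℚ) 0≤A
                     (λ ≤n → ℚₚ.≤-trans (ℚₚ.p⊓q≤p δ₀ 1ℚ) (δ₀≤x (⊔₁ {K} {L} ≤n)))
                     (λ {n} ≤n → ℚₚ.≤-trans (ℚₚ.∣p-q∣≤∣p∣+∣q∣ (seq x n) 1ℚ)
                                   (ℚₚ.+-monoˡ-≤ 1ℚ (x≤A₀ (⊔₂ {K} {L} ≤n))))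
                     (λ ≤m ≤n → proj₂ (cauchy x 0<ε) (⊔₁ {M} {N} ≤m) (⊔₁ {M} {N} ≤n))
                     (ℚₚ.≤-trans (½^-antimono (ℕₚ.m≤n⊔m M N)) (proj₂ (½^-small 0<ε)))
        where
          δ = δ₀ ⊓ 1ℚ
          A = A₀ ⊕ 1ℚ
          D² = recip δ ⊛ recip δ
          C  = ½ ⊛ (A ⊛ A ⊛ D²)
          0<δ : 0ℚ ≺ δ
          0<δ = 0<⊓1 0<δ₀
          0≤A : 0ℚ ≼ A
          0≤A = ℚₚ.+-mono-≤ 0≤A₀ (ℚₚ.<⇒≤ 0<1)
          0≤D² : 0ℚ ≼ D²
          0≤D² = *-nonNeg (0≤recip 0<δ) (0≤recip 0<δ)
          0≤C : 0ℚ ≼ C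
          0≤C = *-nonNeg {½} (ℚₚ.<⇒≤ 0<½) (*-nonNeg (*-nonNeg 0≤A 0≤A) 0≤D²)

  -- If δ ≤ x and ∣y∣ ≤ B eventually, then δ/(1 + B) ≤ x/y eventually.
  0</ : ∀ {s t : ℕ → ℚ} {δ η B L M N} → 0ℚ ≺ δ → 0ℚ ≺ η → 0ℚ ≼ B →
    (∀ {n} → L ℕ.≤ n → δ ≼ s n) → (∀ {n} → M ℕ.≤ n → η ≼ t n) →
    (∀ {n} → N ℕ.≤ n → ∣ t n ∣ ≼ B) →
    ∀ {n} → L ℕ.⊔ (M ℕ.⊔ N) ℕ.≤ n → 0ℚ ⊕ δ ⊛ recip (1ℚ ⊕ B) ≼ s n ⊛ recip (t n)
  0</ {s} {t} {δ} {η} {B} {L} {M} {N} 0<δ 0<η 0≤B δ≤s η≤t t≤B {n} ≤n = begin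
    0ℚ ⊕ δ ⊛ recip (1ℚ ⊕ B)   ≡⟨ ℚₚ.+-identityˡ (δ ⊛ recip (1ℚ ⊕ B)) ⟩
    δ ⊛ recip (1ℚ ⊕ B)        ≤⟨ *-mono-≤ (ℚₚ.<⇒≤ 0<δ) (0≤recip 0<t)
                                   (δ≤s (⊔₁ {L} {M ℕ.⊔ N} ≤n)) (recip-antimono 0<t t≤1+B) ⟩
    s n ⊛ recip (t n)         ∎
    where
      open ℚₚ.≤-Reasoning
      ≤n′ = ⊔₂ {L} {M ℕ.⊔ N} ≤n
      0<t : 0ℚ ≺ t n
      0<t = ℚₚ.<-≤-trans 0<η (η≤t (⊔₁ {M} {N} ≤n′))
      t≤1+B : t n ≼ 1ℚ ⊕ B
      t≤1+B = begin
        t n       ≤⟨ q≤∣q∣ (t n) ⟩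
        ∣ t n ∣   ≤⟨ t≤B (⊔₂ {M} {N} ≤n′) ⟩
        B         ≡⟨ ℚₚ.+-identityˡ B ⟨
        0ℚ ⊕ B    ≤⟨ ℚₚ.+-monoˡ-≤ B (ℚₚ.<⇒≤ 0<1) ⟩
        1ℚ ⊕ B    ∎

_+_ : ℝ → ℝ → ℝ
x + y = mkℝ (λ n → seq x n ℚᵇ.+ seq y n) (ℝ-Lemmas.+-cauchy x y)

_*_ : ℝ → ℝ → ℝ
x * y = mkℝ (λ n → seq x n ℚᵇ.* seq y n) (ℝ-Lemmas.*-cauchy x y)

1/ : (y : ℝ) → 0ℝ < y → ℝ
1/ y 0<y = mkℝ (λ n → recip (seq y n)) (ℝ-Lemmas.recip-cauchy y 0<y)

-- ln x = ∫₁ˣ dt/t, as the limit of left Riemann sums.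
ln : (x : ℝ) → 0ℝ < x → ℝ
ln x 0<x = mkℝ (λ n → lnSum n (seq x n)) (ℝ-Lemmas.ln-cauchy x 0<x)

0</ : ∀ {x y} → 0ℝ < x → (0<y : 0ℝ < y) → 0ℝ < x * 1/ y 0<y
0</ {x} {y} 0<x 0<y = go (positive {x} 0<x) (positive {y} 0<y) (bounded y)
  where
    open ℚ-Lemmas
    open ℝ-Lemmas hiding (0</)
    go : (∃[ δ ] (0ℚ ℚᵇ.< δ × ∃[ N ] (∀ {n} → N ℕ.≤ n → δ ℚᵇ.≤ seq x n))) →
         (∃[ η ] (0ℚ ℚᵇ.< η × ∃[ N ] (∀ {n} → N ℕ.≤ n → η ℚᵇ.≤ seq y n))) →
         (∃[ B ] (0ℚ ℚᵇ.≤ B × ∃[ N ] (∀ {n} → N ℕ.≤ n → ∣ seq y n ∣ ℚᵇ.≤ B))) →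
         0ℝ < x * 1/ y 0<y
    go (δ , 0<δ , L , δ≤x) (η , 0<η , M , η≤y) (B , 0≤B , N , y≤B) =
        δ ℚᵇ.* recip (1ℚ ℚᵇ.+ B)
      , *-pos 0<δ (0<recip (ℚₚ.+-mono-<-≤ 0<1 0≤B))
      , L ℕ.⊔ (M ℕ.⊔ N)
      , ℝ-Lemmas.0</ {seq x} {seq y} {L = L} {M} {N} 0<δ 0<η 0≤B δ≤x η≤y y≤B

------------------------------------------------------------------------
-- Extended reals as lower Dedekind cuts

-- The cut {q ∈ ℚ | q < z} determines z ∈ [-∞,∞].
record ℝ∞ : Set₁ where
  field
    Below   : ℚ → Set
    closed  : ∀ {p q} → p ℚᵇ.< q → Below q → Below p
    rounded : ∀ {q} → Below q → ∃[ p ] (q ℚᵇ.< p × Below p)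

open ℝ∞ public

sup : {I : Set} → (I → ℝ) → ℝ∞
sup {I} a = record
  { Below   = λ q → ∃[ i ] fromℚ q < a i
  ; closed  = λ { {p} {q} p<q (i , ε , 0<ε , N , h) → i , ε , 0<ε , N , λ N≤n →
      ℚₚ.≤-trans (ℚₚ.+-monoˡ-≤ ε (ℚₚ.<⇒≤ p<q)) (h N≤n) }
  ; rounded = λ { {q} (i , ε , 0<ε , N , h) →
      let 0<½ε = *-pos 0<½ 0<ε in
        q ℚᵇ.+ ½ ℚᵇ.* ε
      , subst (ℚᵇ._< q ℚᵇ.+ ½ ℚᵇ.* ε) (ℚₚ.+-identityʳ q) (ℚₚ.+-monoʳ-< q 0<½ε)
      , i , ½ ℚᵇ.* ε , 0<½ε , N , λ {n} N≤n →
          subst (ℚᵇ._≤ seq (a i) n)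
            (trans (cong (q ℚᵇ.+_) (sym (½+½ ε)))
                   (sym (ℚₚ.+-assoc q (½ ℚᵇ.* ε) (½ ℚᵇ.* ε))))
            (h N≤n) }
  }
  where open ℚ-Lemmas

infix 4 _≤∞_

_≤∞_ : ℝ → ℝ∞ → Set
x ≤∞ z = ∀ {q} → fromℚ q < x → Below z q

-- Neither -∞ nor +∞.
Finite : ℝ∞ → Set
Finite z = (∃[ q ] Below z q) × (∃[ B ] (∀ {q} → Below z q → q ℚᵇ.≤ B))

------------------------------------------------------------------------
-- Probability measures on Cantor space

Cantor : Set
Cantor = ℕ → Bool

String : Set
String = List Bool

_↾_ : Cantor → ℕ → String
ω ↾ n = applyUpTo ω n

record ProbabilityMeasure : Set where
  field
    ⟦_⟧      : String → ℝ
    nonNeg   : ∀ σ → 0ℝ ≤ ⟦_⟧ σ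
    total    : ⟦_⟧ [] ≈ 1ℝ
    additive : ∀ σ → ⟦_⟧ σ ≈ ⟦_⟧ (σ ∷ʳ false) + ⟦_⟧ (σ ∷ʳ true)

open ProbabilityMeasure public using (⟦_⟧)

record FullSupport (ν : ProbabilityMeasure) : Set where
  field
    pos : ∀ σ → 0ℝ < ⟦ ν ⟧ σ

open FullSupport {{...}} public

-- The sum of f over the strings of length n.
∑ : ℕ → (String → ℝ) → ℝ
∑ zero    f = f []
∑ (suc n) f = ∑ n (λ σ → f (false ∷ σ)) + ∑ n (λ σ → f (true ∷ σ))

-- A step function ω ↦ value (ω ↾ depth).
record Step : Set where
  constructor step
  field
    depth : ℕ
    value : String → ℝ

open Step public

_at_ : Step → Cantor → ℝ
g at ω = value g (ω ↾ depth g)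

𝔼ₛ : ProbabilityMeasure → Step → ℝ
𝔼ₛ ν g = ∑ (depth g) (λ σ → ⟦ ν ⟧ σ * value g σ)

-- The expectation of an extended-real function, as the supremum of the
-- expectations of the step functions below it.  This is the Lebesgue
-- integral when f is lower semicontinuous and bounded below, in
-- particular when f is a supremum of nonnegative step functions; for
-- other f it is only a lower integral.
𝔼 : ProbabilityMeasure → (Cantor → ℝ∞) → ℝ∞
𝔼 ν f = sup {Σ[ g ∈ Step ] (∀ ω → (g at ω) ≤∞ f ω)} (λ (g , _) → 𝔼ₛ ν g)

module _ (ν μ : ProbabilityMeasure) {{_ : FullSupport ν}} {{_ : FullSupport μ}} where

  ratio : String → ℝ
  ratio σ = ⟦ ν ⟧ σ * 1/ (⟦ μ ⟧ σ) (pos σ)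

  0<ratio : ∀ σ → 0ℝ < ratio σ
  0<ratio σ = 0</ {⟦ ν ⟧ σ} {⟦ μ ⟧ σ} (pos σ) (pos σ)

infix 4 _≪bd_ _≪kl_

_≪bd_ : (ν μ : ProbabilityMeasure) {{_ : FullSupport ν}} {{_ : FullSupport μ}} → Set
ν ≪bd μ = Finite (𝔼 ν (λ ω → sup (λ n → ratio ν μ (ω ↾ n))))

_≪kl_ : (ν μ : ProbabilityMeasure) {{_ : FullSupport ν}} {{_ : FullSupport μ}} → Set
ν ≪kl μ = Finite (sup (λ n → 𝔼ₛ ν (step n (λ σ → ln (ratio ν μ σ) (0<ratio ν μ σ)))))

{-# OPTIONS --safe #-}

-- Since ln x ≤ x - 1, each expectation 𝔼 ln (ν/μ) at depth n is at most
-- 𝔼 (ν/μ) at depth n, which is the expectation of a step function below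
-- supₙ (ν/μ) and hence at most any bound for 𝔼 supₙ (ν/μ).

module Submission where

open import Data.Bool.Base using (true; false)
open import Data.List.Base using ([]; _∷_)
open import Data.Nat.Base as ℕ using (ℕ; zero; suc)
import Data.Nat.Properties as ℕₚ
open import Data.Product.Base using (∃-syntax; _,_; proj₁; proj₂)
open import Data.Rational.Base as ℚᵇ using (0ℚ; 1ℚ; ∣_∣)
open import Data.Rational.Properties as ℚₚ using ()
open import Data.Rational.Solver using (module +-*-Solver)
open import Data.Sum.Base using (inj₁; inj₂)
open import Relation.Binary.PropositionalEquality

open import Defs

open ℚ-Lemmas

module _ where
  open ℚᵇ using (_⊓_) renaming (_+_ to _⊕_; _*_ to _⊛_; _-_ to _⊖_; _≤_ to _≼_; _<_ to _≺_)
  open +-*-Solver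

  Σ<-≤ : ∀ N {f c} → (∀ i → i ℕ.< N → f i ≼ c) → Σ< N f ≼ N ×ℚ c
  Σ<-≤ zero    f≤c = ℚₚ.≤-refl
  Σ<-≤ (suc N) {f} {c} f≤c = subst (Σ< (suc N) f ≼_) (ℚₚ.+-comm (N ×ℚ c) c)
    (ℚₚ.+-mono-≤ (Σ<-≤ N λ i i<N → f≤c i (ℕₚ.m<n⇒m<1+n i<N)) (f≤c N ℕₚ.≤-refl))

  0≤p*p : ∀ p → 0ℚ ≼ p ⊛ p
  0≤p*p p with ℚₚ.≤-total 0ℚ p
  ... | inj₁ 0≤p = *-nonNeg 0≤p 0≤p
  ... | inj₂ p≤0 = ℚₚ.nonNegative⁻¹ (p ⊛ p) {{ℚₚ.nonPos*nonPos⇒nonPos p p}}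
    where
      instance
        _ = ℚᵇ.nonPositive p≤0

  -- With d = 1 + i h, the difference h - h/d is i h²/d.
  h/[1+ih]≤h : ∀ i {h} → 0ℚ ≺ 1ℚ ⊕ i ×ℚ h → h ⊛ recip (1ℚ ⊕ i ×ℚ h) ≼ h
  h/[1+ih]≤h i {h} 0<d = begin
    h ⊛ r                    ≡⟨ ℚₚ.+-identityʳ (h ⊛ r) ⟨
    h ⊛ r ⊕ 0ℚ               ≤⟨ ℚₚ.+-monoʳ-≤ (h ⊛ r)
                                  (*-nonNeg (×-nonNeg i (0≤p*p h)) (0≤recip 0<d)) ⟩
    h ⊛ r ⊕ i ×ℚ (h ⊛ h) ⊛ r ≡⟨ cong (λ s → h ⊛ r ⊕ s ⊛ r) (×-* i h h) ⟩
    h ⊛ r ⊕ i ×ℚ h ⊛ h ⊛ r   ≡⟨ solve 3 (λ h r s → h :* r :+ s :* h :* r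
                                            := h :* ((con 1ℚ :+ s) :* r)) refl h r (i ×ℚ h) ⟩
    h ⊛ ((1ℚ ⊕ i ×ℚ h) ⊛ r)  ≡⟨ cong (h ⊛_) (recip-inverse 0<d) ⟩
    h ⊛ 1ℚ                   ≡⟨ ℚₚ.*-identityʳ h ⟩
    h                        ∎
    where
      open ℚₚ.≤-Reasoning
      r = recip (1ℚ ⊕ i ×ℚ h)

  -- Each of the `2 ^ n` summands is at most the signed mesh `(x - 1)/2ⁿ`, whether `x` lies above or
  -- below 1, and the meshes add up to `x - 1`.
  lnSum≤x-1 : ∀ n {x} → 0ℚ ≺ x → lnSum n x ≼ x ⊖ 1ℚ
  lnSum≤x-1 n {x} 0<x = begin
    lnSum n x                         ≤⟨ Σ<-≤ (2 ℕ.^ n) (λ i i<2^n → h/[1+ih]≤h i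
                                           -- The nodes are convex combinations of 1 and `x`, so
                                           -- `x ⊓ 1ℚ` bounds them from below.
                                           (ℚₚ.<-≤-trans 0<δ
                                             (δ≤node n i (ℚₚ.p⊓q≤p x 1ℚ) (ℕₚ.<⇒≤ i<2^n)))) ⟩
    (2 ℕ.^ n) ×ℚ ((x ⊖ 1ℚ) ⊛ (½^ n))  ≡⟨ cong ((2 ℕ.^ n) ×ℚ_) (ℚₚ.*-comm (x ⊖ 1ℚ) (½^ n)) ⟩
    (2 ℕ.^ n) ×ℚ ((½^ n) ⊛ (x ⊖ 1ℚ))  ≡⟨ 2^n×½^n*c≡c n (x ⊖ 1ℚ) ⟩
    x ⊖ 1ℚ                            ∎
    where
      open ℚₚ.≤-Reasoning
      0<δ : 0ℚ ≺ x ⊓ 1ℚ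
      0<δ = ℝ-Lemmas.0<⊓1 0<x
      open LnSum 0<δ (ℚₚ.p⊓q≤q x 1ℚ)

  lnSum≤x : ∀ n {x} → 0ℚ ≺ x → lnSum n x ≼ x
  lnSum≤x n {x} 0<x = ℚₚ.≤-trans (lnSum≤x-1 n 0<x)
    (subst (x ⊖ 1ℚ ≼_) (ℚₚ.+-identityʳ x) (ℚₚ.+-monoʳ-≤ x (ℚₚ.≤ᵇ⇒≤ _)))

infix 4 _⊑_

-- Eventual domination of the approximants: stronger than _≤_, but
-- sufficient here and preserved by the operations without estimates.
_⊑_ : ℝ → ℝ → Set
x ⊑ y = ∃[ N ] (∀ {n} → N ℕ.≤ n → seq x n ℚᵇ.≤ seq y n)

<-⊑-trans : ∀ {x y z} → x < y → y ⊑ z → x < z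
<-⊑-trans (ε , 0<ε , M , x<y) (N , y≤z) = ε , 0<ε , M ℕ.⊔ N , λ ≤n →
  ℚₚ.≤-trans (x<y (ℝ-Lemmas.⊔₁ {M} {N} ≤n)) (y≤z (ℝ-Lemmas.⊔₂ {M} {N} ≤n))

+-mono-⊑ : ∀ {w x y z} → w ⊑ x → y ⊑ z → w + y ⊑ x + z
+-mono-⊑ (M , w≤x) (N , y≤z) = M ℕ.⊔ N , λ ≤n →
  ℚₚ.+-mono-≤ (w≤x (ℝ-Lemmas.⊔₁ {M} {N} ≤n)) (y≤z (ℝ-Lemmas.⊔₂ {M} {N} ≤n))

-- Strict positivity keeps the approximants of `x` eventually above some `δ > 0`; `0ℝ ≤ x` would
-- still allow slightly negative ones.
*-monoˡ-⊑ : ∀ {x y z} → 0ℝ < x → y ⊑ z → x * y ⊑ x * z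
*-monoˡ-⊑ {x} 0<x (N , y≤z) =
  let δ , 0<δ , M , δ≤x = ℝ-Lemmas.positive {x} 0<x in
  M ℕ.⊔ N , λ {n} ≤n → ℚₚ.*-monoˡ-≤-nonNeg (seq x n)
    {{ℚᵇ.nonNegative (ℚₚ.≤-trans (ℚₚ.<⇒≤ 0<δ) (δ≤x (ℝ-Lemmas.⊔₁ {M} {N} ≤n)))}}
    (y≤z (ℝ-Lemmas.⊔₂ {M} {N} ≤n))

-- The threshold of `f σ ⊑ g σ` may depend on `σ`, but only finitely many strings occur, so a
-- maximum exists.
∑-mono-⊑ : ∀ n {f g} → (∀ σ → f σ ⊑ g σ) → ∑ n f ⊑ ∑ n g
∑-mono-⊑ zero    f⊑g = f⊑g []
∑-mono-⊑ (suc n) {f} {g} f⊑g = +-mono-⊑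
  {∑ n (λ σ → f (false ∷ σ))} {∑ n (λ σ → g (false ∷ σ))}
  {∑ n (λ σ → f (true ∷ σ))} {∑ n (λ σ → g (true ∷ σ))}
  (∑-mono-⊑ n (λ σ → f⊑g (false ∷ σ))) (∑-mono-⊑ n (λ σ → f⊑g (true ∷ σ)))

𝔼ₛ-mono-⊑ : ∀ ν {{_ : FullSupport ν}} n f g →
  (∀ σ → f σ ⊑ g σ) → 𝔼ₛ ν (step n f) ⊑ 𝔼ₛ ν (step n g)
𝔼ₛ-mono-⊑ ν n f g f⊑g = ∑-mono-⊑ n λ σ →
  *-monoˡ-⊑ {⟦ ν ⟧ σ} {f σ} {g σ} (pos σ) (f⊑g σ)

ln⊑id : ∀ x (0<x : 0ℝ < x) → ln x 0<x ⊑ x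
ln⊑id x 0<x =
  let δ , 0<δ , N , δ≤x = ℝ-Lemmas.positive {x} 0<x in
  N , λ {n} N≤n → lnSum≤x n (ℚₚ.<-≤-trans 0<δ (δ≤x N≤n))

∃-below : ∀ x → ∃[ q ] fromℚ q < x
∃-below x =
  let A , _ , N , ∣x∣≤A = ℝ-Lemmas.bounded x in
  -- Eventually `- A ≤ seq x n`; subtracting 1 more provides the gap that `_<_` demands.
  ℚᵇ.- A ℚᵇ.- 1ℚ , 1ℚ , 0<1 , N , λ {n} N≤n → begin
    ℚᵇ.- A ℚᵇ.- 1ℚ ℚᵇ.+ 1ℚ       ≡⟨ solve 1 (λ a → :- a :- con 1ℚ :+ con 1ℚ := :- a) refl A ⟩
    ℚᵇ.- A                       ≤⟨ ℚₚ.neg-antimono-≤ (∣x∣≤A N≤n) ⟩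
    ℚᵇ.- ∣ seq x n ∣             ≡⟨ cong ℚᵇ.-_ (ℚₚ.∣-p∣≡∣p∣ (seq x n)) ⟨
    ℚᵇ.- ∣ ℚᵇ.- seq x n ∣        ≤⟨ ℚₚ.neg-antimono-≤ (q≤∣q∣ (ℚᵇ.- seq x n)) ⟩
    ℚᵇ.- (ℚᵇ.- seq x n)          ≡⟨ solve 1 (λ a → :- (:- a) := a) refl (seq x n) ⟩
    seq x n                      ∎
  where
    open ℚₚ.≤-Reasoning
    open +-*-Solver

𝔼sup-finite⇒sup𝔼-finite : ∀ ν {{_ : FullSupport ν}} {f g} → (∀ σ → f σ ⊑ g σ) →
  Finite (𝔼 ν (λ ω → sup (λ n → g (ω ↾ n)))) → Finite (sup (λ n → 𝔼ₛ ν (step n f)))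
𝔼sup-finite⇒sup𝔼-finite ν {f} {g} f⊑g (_ , B , 𝔼sup≤B) =
    -- A rational below one term is below the supremum, so depth 0 suffices.
    (proj₁ 𝔼f₀-below , 0 , proj₂ 𝔼f₀-below)
  , B , λ { {q} (n , q<𝔼f) → 𝔼sup≤B
      -- At `ω` the step function `step n g` is the `n`-th term of the supremum, so it competes in
      -- the lower integral and the same `B` bounds its expectation.
      ( (step n g , λ ω q<g → n , q<g)
      , <-⊑-trans {fromℚ q} {𝔼ₛ ν (step n f)} {𝔼ₛ ν (step n g)} q<𝔼f (𝔼ₛ-mono-⊑ ν n f g f⊑g)) }
  where
    𝔼f₀-below = ∃-below (𝔼ₛ ν (step 0 f))

proposition6p4 : (ν μ : ProbabilityMeasure) {{_ : FullSupport ν}} {{_ : FullSupport μ}} → ν ≪bd μ → ν ≪kl μ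
proposition6p4 ν μ {{i}} {{j}} = 𝔼sup-finite⇒sup𝔼-finite ν {{i}}
  {λ σ → ln (ratio ν μ {{i}} {{j}} σ) (0<ratio ν μ {{i}} {{j}} σ)} {ratio ν μ {{i}} {{j}}}
  (λ σ → ln⊑id (ratio ν μ {{i}} {{j}} σ) (0<ratio ν μ {{i}} {{j}} σ))
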